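{- For every integer $n\ge 6$, there exists a nonbipartite graph of order $n$ and size $\left\lfloor (n-1)^2/4\right\rfloor+2$ that contains exactly three weakly pancyclic vertices.
   Context: All graphs are finite and simple. The order of a graph is its number of vertices and its size is its number of edges. The girth $g(G)$ is the length of a shortest cycle of $G$, and the circumference $c(G)$ is the length of a longest cycle of $G$. A vertex $v$ of $G$ is called weakly pancyclic if for every integer $\ell$ with $g(G)\le \ell\le c(G)$, $v$ lies on a cycle of length $\ell$ in $G$. -}

module Defs where

open import Data.Bool.Base using (Bool)
open import Data.Fin.Base using (Fin)
open import Data.Fin.Properties using (_<?_)
open import Data.Fin.Subset using (Subset; ∣_∣) renaming (_∈_ to _∈ₛ_)
open import Data.List.Base as List using (List; _∷_; _∷ʳ_; allFin; cartesianProduct; filter)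
open import Data.List.Membership.Propositional using (_∈_)
open import Data.List.Relation.Unary.Linked using (Linked)
open import Data.List.Relation.Unary.Unique.Propositional using (Unique)
open import Data.Nat.Base using (ℕ; _≤_)
open import Data.Product.Base using (Σ-syntax; ∃-syntax; _×_; _,_)
open import Function.Bundles using (_⇔_)
open import Level using (0ℓ)
open import Relation.Binary.Core using (Rel)
open import Relation.Binary.Definitions using (Decidable; Irreflexive; Symmetric)
open import Relation.Binary.PropositionalEquality.Core using (_≡_; _≢_)
open import Relation.Nullary.Decidable.Core using (_×-dec_)
open import Relation.Unary using (Pred)

record Graph (n : ℕ) : Set₁ where
  field
    Adj         : Rel (Fin n) 0ℓ
    adj?        : Decidable Adj
    symmetric   : Symmetric Adj
    irreflexive : Irreflexive _≡_ Adj

  -- An edge {u , v} is listed once, as the ordered pair with u < v.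
  edges : List (Fin n × Fin n)
  edges = filter (λ (u , v) → (u <? v) ×-dec adj? u v)
                 (cartesianProduct (allFin n) (allFin n))

  size : ℕ
  size = List.length edges

open Graph public using (size)

Bipartite : ∀ {n} → Graph n → Set
Bipartite {n} G = Σ[ side ∈ (Fin n → Bool) ] (∀ u v → Adj u v → side u ≢ side v)
  where open Graph G

-- A cycle is presented by its distinct vertices in cyclic order, from a chosen
-- start and in a chosen direction; each cycle thus has several presentations.
record Cycle {n} (G : Graph n) : Set where
  open Graph G
  field
    start : Fin n
    rest  : List (Fin n)

  vertices : List (Fin n)
  vertices = start ∷ rest

  length : ℕ
  length = List.length vertices

  field
    distinct : Unique vertices
    closed   : Linked Adj (vertices ∷ʳ start)
    3≤length : 3 ≤ length

LiesOnCycleOfLength : ∀ {n} → Graph n → Fin n → ℕ → Set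
LiesOnCycleOfLength G v ℓ = Σ[ C ∈ Cycle G ] (Cycle.length C ≡ ℓ × v ∈ Cycle.vertices C)

-- Girth and circumference are relations because an acyclic graph has neither.
IsGirth : ∀ {n} → Graph n → ℕ → Set
IsGirth G g = (Σ[ C ∈ Cycle G ] Cycle.length C ≡ g) × (∀ (C : Cycle G) → g ≤ Cycle.length C)

IsCircumference : ∀ {n} → Graph n → ℕ → Set
IsCircumference G c = (Σ[ C ∈ Cycle G ] Cycle.length C ≡ c) × (∀ (C : Cycle G) → Cycle.length C ≤ c)

WeaklyPancyclic : ∀ {n} → Graph n → Fin n → Set
WeaklyPancyclic G v =
  ∀ g c → IsGirth G g → IsCircumference G c →
  ∀ ℓ → g ≤ ℓ → ℓ ≤ c → LiesOnCycleOfLength G v ℓ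

HoldsForExactly : ∀ {n} → ℕ → Pred (Fin n) 0ℓ → Set
HoldsForExactly {n} k P = ∃[ S ] (∣ S ∣ ≡ k × (∀ (v : Fin n) → v ∈ₛ S ⇔ P v))

{-# OPTIONS --safe #-}
-- Vertices are numbered 0, …, n - 1.  Start from the complete bipartite graph
-- between the even and the odd numbers, add the edge {0, 2}, and delete {0, 3}
-- and all edges {2, j} with j ≥ 5.  Each odd number other than 1 is left adjacent
-- to exactly one of 0 and 2, so {0, 1, 2} is the only triangle and no vertex
-- outside it is weakly pancyclic.  The cycles 1, 0, 2, 3, …, ℓ - 1 (ℓ odd) and
-- 0, 1, 2, 3, …, ℓ - 1 (ℓ ≥ 6 even) pass through all of 0, 1, 2; in particular
-- the graph is Hamiltonian.  Length 4 is covered by 0, 1, 4, 5 and 1, 2, 3, 4.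
module Submission where

open import Defs
open import Data.Bool.Base using (Bool; true; false; not; _∧_; _xor_; T)
open import Data.Bool.Properties using (T?; xor-annihilates-not; xor-identityʳ)
open import Data.Empty using (⊥; ⊥-elim)
open import Data.Fin.Base using (Fin; zero; suc; toℕ; fromℕ<)
open import Data.Fin.Properties using (toℕ-fromℕ<; toℕ-injective; injective⇒≤)
open import Data.Fin.Subset using (Subset; inside) renaming (⊥ to ∅; _∈_ to _∈ₛ_)
open import Data.Fin.Subset.Properties using (∉⊥; ∣⊥∣≡0)
open import Data.List.Base as List
  using (List; []; _∷_; _∷ʳ_; _++_; applyUpTo; cartesianProduct; filter; lookup; map; tabulate)
open import Data.List.Membership.Propositional using (_∈_)
open import Data.List.Membership.Propositional.Properties using (∈-map⁻; ∈-lookup)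
open import Data.List.Properties
  using (filter-++; length-++; length-applyUpTo; length-map; map-++; map-tabulate)
open import Data.List.Relation.Unary.All as All using (All; []; _∷_)
import Data.List.Relation.Unary.All.Properties as All
open import Data.List.Relation.Unary.AllPairs using ([]; _∷_)
open import Data.List.Relation.Unary.Any using (here; there)
open import Data.List.Relation.Unary.Linked using (Linked; [-]; _∷_)
import Data.List.Relation.Unary.Linked.Properties as Linked
open import Data.List.Relation.Unary.Unique.Propositional using (Unique)
import Data.List.Relation.Unary.Unique.Propositional.Properties as Unique
open import Data.List.Relation.Unary.Unique.DecPropositional using (unique?)
open import Data.Nat.Base
  using (ℕ; zero; suc; _+_; _*_; _∸_; _^_; _/_; _≤_; _<_; _<ᵇ_; ∣_-_∣; ⌊_/2⌋; ⌈_/2⌉; z≤n; s≤s)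
open import Data.Nat.Divisibility using (n∣m*n)
open import Data.Nat.DivMod using (+-distrib-/-∣ʳ; m*n/n≡m)
open import Data.Nat.Properties
  using (_≟_; _<?_; +-assoc; +-comm; +-monoʳ-<; <-≤-trans; <⇒≢; ≤-refl; ≤-trans; ∣-∣-comm; ⌊n/2⌋+⌈n/2⌉≡n)
open import Data.Nat.Tactic.RingSolver using (solve-∀)
open import Data.Product.Base using (Σ-syntax; ∃-syntax; _×_; _,_)
open import Data.Sum.Base using (_⊎_; inj₁; inj₂)
open import Data.Unit.Base using (tt)
open import Data.Vec.Base using (_∷_; here; there)
open import Function.Base using (_∘_; id)
open import Function.Bundles using (mk⇔)
open import Level using (0ℓ)
open import Relation.Binary.PropositionalEquality
  using (_≡_; _≢_; refl; sym; trans; cong; cong₂; subst; module ≡-Reasoning)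
open import Relation.Nullary.Decidable using (does; toWitness)
open import Relation.Nullary.Negation.Core using (¬_)
open import Relation.Unary using (Pred; Decidable)

-- Parity and the construction of the graph

odd : ℕ → Bool
odd 0             = false
odd 1             = true
odd (suc (suc n)) = odd n

odd-suc : ∀ n → odd (suc n) ≡ not (odd n)
odd-suc 0             = refl
odd-suc 1             = refl
odd-suc (suc (suc n)) = odd-suc n

-- Passes from differences to parities, the form to which `xor-triangle-free` applies.
odd-∣-∣ : ∀ i j → odd ∣ i - j ∣ ≡ odd i xor odd j
odd-∣-∣ zero    j       = refl
odd-∣-∣ (suc i) zero    = sym (xor-identityʳ (odd (suc i)))
odd-∣-∣ (suc i) (suc j)
  rewrite odd-suc i | odd-suc j | xor-annihilates-not (odd i) (odd j) = odd-∣-∣ i j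

odd-or-odd-suc : ∀ n → T (odd n) ⊎ T (odd (suc n))
odd-or-odd-suc 0             = inj₂ tt
odd-or-odd-suc 1             = inj₁ tt
odd-or-odd-suc (suc (suc n)) = odd-or-odd-suc n

-- Each argument occurs twice, so the three xors cancel and cannot all be `true`.
xor-triangle-free : ∀ a b c → T (a xor b) → T (b xor c) → T (c xor a) → ⊥
xor-triangle-free false true  true  _ () _
xor-triangle-free false true  false _ _ ()
xor-triangle-free true  false false _ () _
xor-triangle-free true  false true  _ _ ()

-- With the difference, `alternating (suc i) (suc j)` reduces to `alternating i j`: removing the
-- first vertex leaves the same graph.
alternating : ℕ → ℕ → Bool
alternating i j = odd ∣ i - j ∣

alternating-suc : ∀ i → T (alternating i (suc i))
alternating-suc zero    = tt
alternating-suc (suc i) = alternating-suc i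

-- A new vertex 0 with neighbourhood r is added, the old vertices moving up by one.
cone : (ℕ → Bool) → (ℕ → ℕ → Bool) → ℕ → ℕ → Bool
cone r e zero    zero    = false
cone r e zero    (suc j) = r j
cone r e (suc i) zero    = r i
cone r e (suc i) (suc j) = e i j

module _ {r : ℕ → Bool} {e : ℕ → ℕ → Bool} where

  cone-comm : (∀ i j → e i j ≡ e j i) → ∀ i j → cone r e i j ≡ cone r e j i
  cone-comm comm zero    zero    = refl
  cone-comm comm zero    (suc j) = refl
  cone-comm comm (suc i) zero    = refl
  cone-comm comm (suc i) (suc j) = comm i j

  cone-irrefl : (∀ i → ¬ T (e i i)) → ∀ i → ¬ T (cone r e i i)
  cone-irrefl irrefl (suc i) = irrefl i

-- nbrsᵢ j tells whether i is adjacent to i + 1 + j.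
nbrs₀ nbrs₁ nbrs₂ : ℕ → Bool
nbrs₀ 0                   = true
nbrs₀ 1                   = true
nbrs₀ 2                   = false
nbrs₀ (suc (suc (suc j))) = odd j
nbrs₁ zero    = true
nbrs₁ (suc j) = odd j
nbrs₂ zero    = true
nbrs₂ (suc _) = false

-- The vertices from 3 on are renumbered from 0. This swaps the parity classes, but `alternating`
-- depends on differences only.
adjacent : ℕ → ℕ → Bool
adjacent = cone nbrs₀ (cone nbrs₁ (cone nbrs₂ alternating))

infix 4 _~_
_~_ : ℕ → ℕ → Set
i ~ j = T (adjacent i j)

adjacent-comm : ∀ i j → adjacent i j ≡ adjacent j i
adjacent-comm = cone-comm (cone-comm (cone-comm λ i j → cong odd (∣-∣-comm i j)))

~-irrefl : ∀ i → ¬ i ~ i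
~-irrefl = cone-irrefl (cone-irrefl (cone-irrefl alternating-irrefl))
  where
  alternating-irrefl : ∀ i → ¬ T (alternating i i)
  alternating-irrefl (suc i) = alternating-irrefl i

-- These edges form the path 2, 3, 4, ... that the long cycles follow.
~-suc : ∀ i → 2 + i ~ 3 + i
~-suc zero    = tt
~-suc (suc i) = alternating-suc i

G : ∀ n → Graph n
G n = record
  { Adj         = λ u v → toℕ u ~ toℕ v
  ; adj?        = λ u v → T? (adjacent (toℕ u) (toℕ v))
  ; symmetric   = λ {u} {v} → subst T (adjacent-comm (toℕ u) (toℕ v))
  ; irreflexive = λ { {u} refl → ~-irrefl (toℕ u) }
  }

-- Triangles

-- The only edge inside a parity class, in its two orientations.
data Exceptional : ℕ → ℕ → Set where
  02-edge : Exceptional 0 2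
  20-edge : Exceptional 2 0

~-parity : ∀ i j → i ~ j → T (alternating i j) ⊎ Exceptional i j
~-parity 0 1 _ = inj₁ tt
~-parity 0 2 _ = inj₂ 02-edge
~-parity 0 (suc (suc (suc (suc j)))) p = inj₁ p
~-parity 1 0 _ = inj₁ tt
~-parity 1 2 _ = inj₁ tt
~-parity 1 (suc (suc (suc j))) p = inj₁ p
~-parity 2 0 _ = inj₂ 20-edge
~-parity 2 1 _ = inj₁ tt
~-parity 2 3 _ = inj₁ tt
~-parity (suc (suc (suc (suc i)))) 0 p = inj₁ p
~-parity (suc (suc (suc i))) 1 p = inj₁ p
~-parity 3 2 _ = inj₁ tt
~-parity (suc (suc (suc i))) (suc (suc (suc j))) p = inj₁ p

-- Vertex 3 is not adjacent to 0, and no vertex from 4 on is adjacent to 2.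
no-common-neighbour : ∀ i → 3 + i ~ 0 → 3 + i ~ 2 → ⊥
no-common-neighbour zero ()

-- If `i` is at least 3, only the opposite edge `j k` can be {0, 2}, and then `i` is a common
-- neighbour of 0 and 2. Otherwise the parity changes three times around the triangle.
triangle⇒<3 : ∀ i j k → i ~ j → j ~ k → k ~ i → i < 3
triangle⇒<3 0 _ _ _ _ _ = s≤s z≤n
triangle⇒<3 1 _ _ _ _ _ = s≤s (s≤s z≤n)
triangle⇒<3 2 _ _ _ _ _ = ≤-refl
triangle⇒<3 (suc (suc (suc i))) j k ij jk ki
  with ~-parity (3 + i) j ij | ~-parity j k jk | ~-parity k (3 + i) ki
... | inj₁ _ | inj₂ 02-edge | _ = ⊥-elim (no-common-neighbour i ij (subst T (adjacent-comm 2 (3 + i)) ki))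
... | inj₁ _ | inj₂ 20-edge | _ = ⊥-elim (no-common-neighbour i (subst T (adjacent-comm 0 (3 + i)) ki) ij)
... | inj₁ p | inj₁ q | inj₁ r = ⊥-elim (xor-triangle-free (odd (3 + i)) (odd j) (odd k)
  (subst T (odd-∣-∣ (3 + i) j) p) (subst T (odd-∣-∣ j k) q) (subst T (odd-∣-∣ k (3 + i)) r))

on-triangle⇒<3 : ∀ {n} {v : Fin n} → LiesOnCycleOfLength (G n) v 3 → toℕ v < 3
on-triangle⇒<3 (record { start = x ; rest = y ∷ z ∷ [] ; closed = xy ∷ yz ∷ zx ∷ [-] } , refl , v∈) with v∈
... | here refl                 = triangle⇒<3 (toℕ x) (toℕ y) (toℕ z) xy yz zx
... | there (here refl)         = triangle⇒<3 (toℕ y) (toℕ z) (toℕ x) yz zx xy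
... | there (there (here refl)) = triangle⇒<3 (toℕ z) (toℕ x) (toℕ y) zx xy yz

¬bipartite : ∀ m → ¬ Bipartite (G (3 + m))
¬bipartite m (side , proper) = two-coloured (side zero) (side (suc zero)) (side (suc (suc zero)))
  (proper _ _ tt) (proper _ _ tt) (proper _ _ tt)
  where
  two-coloured : ∀ a b c → a ≢ b → b ≢ c → a ≢ c → ⊥
  two-coloured false false _     ab _  _  = ab refl
  two-coloured true  true  _     ab _  _  = ab refl
  two-coloured false true  true  _  bc _  = bc refl
  two-coloured true  false false _  bc _  = bc refl
  two-coloured false true  false _  _  ac = ac refl
  two-coloured true  false true  _  _  ac = ac refl

-- Cycles

Unique⇒lookup-injective : ∀ {A : Set} {xs : List A} → Unique xs →
                          ∀ {i j} → lookup xs i ≡ lookup xs j → i ≡ j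
Unique⇒lookup-injective (_ ∷ _)    {zero}  {zero}  _  = refl
Unique⇒lookup-injective (x∉ ∷ _)   {zero}  {suc j} eq = ⊥-elim (All.lookup x∉ (∈-lookup j) eq)
Unique⇒lookup-injective (x∉ ∷ _)   {suc i} {zero}  eq = ⊥-elim (All.lookup x∉ (∈-lookup i) (sym eq))
Unique⇒lookup-injective (_ ∷ xs!)  {suc i} {suc j} eq = cong suc (Unique⇒lookup-injective xs! eq)

-- Pigeonhole: looking up positions in a list of distinct vertices is injective.
cycle-length≤order : ∀ {n} {G : Graph n} (C : Cycle G) → Cycle.length C ≤ n
cycle-length≤order C = injective⇒≤ (Unique⇒lookup-injective (Cycle.distinct C))

map-toℕ⁻ : ∀ {n ks} → All (_< n) ks → ∃[ xs ] map (toℕ {n}) xs ≡ ks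
map-toℕ⁻ []           = [] , refl
map-toℕ⁻ (k<n ∷ ks<n) with xs , eq ← map-toℕ⁻ ks<n =
  fromℕ< k<n ∷ xs , cong₂ _∷_ (toℕ-fromℕ< k<n) eq

-- Lets cycles be written as lists of natural numbers, uniformly in the order `n`.
liesOnCycle : ∀ {n} s ks → All (_< n) (s ∷ ks) → Unique (s ∷ ks) → Linked _~_ (s ∷ ks ∷ʳ s) →
              3 ≤ List.length (s ∷ ks) →
              ∀ (v : Fin n) → toℕ v ∈ s ∷ ks → LiesOnCycleOfLength (G n) v (List.length (s ∷ ks))
liesOnCycle s ks bounds uniq linked 3≤ v v∈ with map-toℕ⁻ bounds
... | x ∷ xs , refl = record
  { start    = x
  ; rest     = xs
  ; distinct = Unique.map⁻ uniq
  ; closed   = Linked.map⁻ (subst (Linked _~_) (sym (map-++ toℕ (x ∷ xs) (x ∷ []))) linked)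
  ; 3≤length = subst (3 ≤_) length≡ 3≤
  } , sym length≡ , v∈xs
  where
  length≡ = cong suc (length-map toℕ xs)

  v∈xs : v ∈ x ∷ xs
  v∈xs with y , y∈ , eq ← ∈-map⁻ toℕ v∈ rewrite toℕ-injective eq = y∈

linked-applyUpTo-∷ʳ : ∀ {A : Set} {R : A → A → Set} f k {s} → (∀ i → R (f i) (f (suc i))) →
                      R (f k) s → Linked R (applyUpTo f (suc k) ∷ʳ s)
linked-applyUpTo-∷ʳ f zero    step last = last ∷ [-]
linked-applyUpTo-∷ʳ f (suc k) step last = step 0 ∷ linked-applyUpTo-∷ʳ (f ∘ suc) k (step ∘ suc) last

-- The cycle is `s, t, 2, 3, …, 2 + k`, where `s` and `t` are 0 and 1 in the order for which the
-- closing edge exists. For `k = 0` it is the triangle.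
liesOnLongCycle : ∀ {n} k s t → s < 2 → t < 2 → s ≢ t → s ~ t → t ~ 2 → 2 + k ~ s → 3 + k ≤ n →
                  ∀ (v : Fin n) → toℕ v ∈ s ∷ t ∷ 2 ∷ [] → LiesOnCycleOfLength (G n) v (3 + k)
liesOnLongCycle {n} k s t s<2 t<2 s≢t st t2 ks k≤n v v∈ =
  subst (LiesOnCycleOfLength (G n) v) (cong (2 +_) (length-applyUpTo (2 +_) (suc k)))
    (liesOnCycle s (t ∷ applyUpTo (2 +_) (suc k))
      ( bound s<2 ∷ bound t<2
      ∷ All.applyUpTo⁺₁ (2 +_) (suc k) (λ i<k → <-≤-trans (+-monoʳ-< 2 i<k) k≤n))
      ( (s≢t ∷ distinct s<2) ∷ distinct t<2
      ∷ Unique.applyUpTo⁺₁ (2 +_) (suc k) (λ i<j _ → <⇒≢ (+-monoʳ-< 2 i<j)))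
      (st ∷ t2 ∷ linked-applyUpTo-∷ʳ (2 +_) k ~-suc ks)
      (s≤s (s≤s (s≤s z≤n))) v (enlarge v∈))
  where
  bound : ∀ {i} → i < 2 → i < n
  bound i<2 = <-≤-trans i<2 (<-≤-trans (s≤s (s≤s z≤n)) k≤n)

  distinct : ∀ {i} → i < 2 → All (i ≢_) (applyUpTo (2 +_) (suc k))
  distinct i<2 = All.applyUpTo⁺₂ (2 +_) (suc k) (λ j → <⇒≢ (<-≤-trans i<2 (s≤s (s≤s z≤n))))

  enlarge : ∀ {i} → i ∈ s ∷ t ∷ 2 ∷ [] → i ∈ s ∷ t ∷ applyUpTo (2 +_) (suc k)
  enlarge (here eq)                 = here eq
  enlarge (there (here eq))         = there (here eq)
  enlarge (there (there (here eq))) = there (there (here eq))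

-- The pattern of `liesOnLongCycle` fails at length 4, because 3 is adjacent neither to 0 nor to 1.
liesOn4Cycle : ∀ {m} (v : Fin (6 + m)) → toℕ v < 3 → LiesOnCycleOfLength (G (6 + m)) v 4
liesOn4Cycle {m} v v<3 = helper (toℕ v) v<3 refl
  where
  -- The bound 6 comes from vertex 5, the least odd neighbour of 0 other than 1.
  bounded : ∀ {ks} → All (_< 6) ks → All (_< 6 + m) ks
  bounded = All.map (λ k<6 → <-≤-trans k<6 (s≤s (s≤s (s≤s (s≤s (s≤s (s≤s z≤n)))))))

  through-0 : toℕ v ∈ 0 ∷ 1 ∷ 4 ∷ 5 ∷ [] → LiesOnCycleOfLength (G (6 + m)) v 4
  through-0 = liesOnCycle 0 (1 ∷ 4 ∷ 5 ∷ [])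
    (bounded (toWitness {a? = All.all? (_<? 6) _} tt))
    (toWitness {a? = unique? _≟_ _} tt)
    (tt ∷ tt ∷ tt ∷ tt ∷ [-]) (s≤s (s≤s (s≤s z≤n))) v

  through-2 : toℕ v ∈ 1 ∷ 2 ∷ 3 ∷ 4 ∷ [] → LiesOnCycleOfLength (G (6 + m)) v 4
  through-2 = liesOnCycle 1 (2 ∷ 3 ∷ 4 ∷ [])
    (bounded (toWitness {a? = All.all? (_<? 6) _} tt))
    (toWitness {a? = unique? _≟_ _} tt)
    (tt ∷ tt ∷ tt ∷ tt ∷ [-]) (s≤s (s≤s (s≤s z≤n))) v

  helper : ∀ i → i < 3 → toℕ v ≡ i → LiesOnCycleOfLength (G (6 + m)) v 4
  helper 0 _ eq = through-0 (here eq)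
  helper 1 _ eq = through-0 (there (here eq))
  helper 2 _ eq = through-2 (there (here eq))
  helper (suc (suc (suc _))) (s≤s (s≤s (s≤s ())))

<3⇒∈012 : ∀ {i} → i < 3 → i ∈ 0 ∷ 1 ∷ 2 ∷ []
<3⇒∈012 {0} _ = here refl
<3⇒∈012 {1} _ = there (here refl)
<3⇒∈012 {2} _ = there (there (here refl))
<3⇒∈012 {suc (suc (suc _))} (s≤s (s≤s (s≤s ())))

<3⇒∈102 : ∀ {i} → i < 3 → i ∈ 1 ∷ 0 ∷ 2 ∷ []
<3⇒∈102 {0} _ = there (here refl)
<3⇒∈102 {1} _ = here refl
<3⇒∈102 {2} _ = there (there (here refl))
<3⇒∈102 {suc (suc (suc _))} (s≤s (s≤s (s≤s ())))

<3⇒liesOnAllCycles : ∀ {m} (v : Fin (6 + m)) → toℕ v < 3 → ∀ ℓ → 3 ≤ ℓ → ℓ ≤ 6 + m →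
                     LiesOnCycleOfLength (G (6 + m)) v ℓ
<3⇒liesOnAllCycles v v<3 1 (s≤s ())
<3⇒liesOnAllCycles v v<3 2 (s≤s (s≤s ()))
<3⇒liesOnAllCycles v v<3 3 _ ℓ≤n =
  liesOnLongCycle 0 1 0 (s≤s (s≤s z≤n)) (s≤s z≤n) (λ ()) tt tt tt ℓ≤n v (<3⇒∈102 v<3)
<3⇒liesOnAllCycles v v<3 4 _ _ = liesOn4Cycle v v<3
-- Here `ℓ = 5 + i` and the path ends at `4 + i`, which is adjacent to 0 if `i` is odd and to 1 if
-- `i` is even; the cycle starts at that neighbour.
<3⇒liesOnAllCycles v v<3 (suc (suc (suc (suc (suc i))))) _ ℓ≤n with odd-or-odd-suc i
... | inj₁ p = liesOnLongCycle (2 + i) 0 1 (s≤s z≤n) (s≤s (s≤s z≤n)) (λ ()) tt tt p ℓ≤n v (<3⇒∈012 v<3)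
... | inj₂ p = liesOnLongCycle (2 + i) 1 0 (s≤s (s≤s z≤n)) (s≤s z≤n) (λ ()) tt tt p ℓ≤n v (<3⇒∈102 v<3)

-- Girth, circumference and the weakly pancyclic vertices

module _ (m : ℕ) where

  private
    n = 6 + m

    3≤n : 3 ≤ n
    3≤n = s≤s (s≤s (s≤s z≤n))

  isGirth : IsGirth (G n) 3
  isGirth with C , length≡ , _ ← <3⇒liesOnAllCycles zero (s≤s z≤n) 3 ≤-refl 3≤n =
    (C , length≡) , Cycle.3≤length

  isCircumference : IsCircumference (G n) n
  isCircumference with C , length≡ , _ ← <3⇒liesOnAllCycles zero (s≤s z≤n) n 3≤n ≤-refl =
    (C , length≡) , cycle-length≤order

  -- The cycles attaining `g` and `c` give `3 ≤ g` and `c ≤ n`.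
  <3⇒weaklyPancyclic : (v : Fin n) → toℕ v < 3 → WeaklyPancyclic (G n) v
  <3⇒weaklyPancyclic v v<3 g c ((C , refl) , _) ((D , refl) , _) ℓ g≤ℓ ℓ≤c =
    <3⇒liesOnAllCycles v v<3 ℓ (≤-trans (Cycle.3≤length C) g≤ℓ)
      (≤-trans ℓ≤c (cycle-length≤order D))

  -- As the girth is 3, such a vertex must lie on a triangle.
  weaklyPancyclic⇒<3 : (v : Fin n) → WeaklyPancyclic (G n) v → toℕ v < 3
  weaklyPancyclic⇒<3 v wp = on-triangle⇒<3 (wp 3 n isGirth isCircumference 3 ≤-refl 3≤n)

  exactlyThree : HoldsForExactly 3 (WeaklyPancyclic (G n))
  exactlyThree = S , cong (3 +_) (∣⊥∣≡0 (3 + m)) , λ v →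
    mk⇔ (<3⇒weaklyPancyclic v ∘ ∈S⇒<3) (<3⇒∈S ∘ weaklyPancyclic⇒<3 v)
    where
    S : Subset n
    S = inside ∷ inside ∷ inside ∷ ∅

    ∈S⇒<3 : ∀ {v} → v ∈ₛ S → toℕ v < 3
    ∈S⇒<3 {zero}                _                          = s≤s z≤n
    ∈S⇒<3 {suc zero}            _                          = s≤s (s≤s z≤n)
    ∈S⇒<3 {suc (suc zero)}      _                          = s≤s (s≤s (s≤s z≤n))
    ∈S⇒<3 {suc (suc (suc v))}   (there (there (there v∈∅))) = ⊥-elim (∉⊥ v∈∅)

    <3⇒∈S : ∀ {v} → toℕ v < 3 → v ∈ₛ S
    <3⇒∈S {zero}              _ = here
    <3⇒∈S {suc zero}          _ = there here
    <3⇒∈S {suc (suc zero)}    _ = there (there here)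
    <3⇒∈S {suc (suc (suc _))} (s≤s (s≤s (s≤s ())))

-- Size

∑ : ℕ → (ℕ → ℕ) → ℕ
∑ zero    f = 0
∑ (suc n) f = f 0 + ∑ n (f ∘ suc)

indicator : Bool → ℕ
indicator false = 0
indicator true  = 1

module _ {A : Set} {P : Pred A 0ℓ} (P? : Decidable P) where

  -- Recording the decisions as Booleans indexed by ℕ removes `Fin` from the count.
  length-filter-tabulate : ∀ {n} (f : Fin n → A) (b : ℕ → Bool) → (∀ i → does (P? (f i)) ≡ b (toℕ i)) →
                           List.length (filter P? (tabulate f)) ≡ ∑ n (indicator ∘ b)
  length-filter-tabulate {zero}  f b eq = refl
  length-filter-tabulate {suc n} f b eq
    with does (P? (f zero)) | b 0 | eq zero | length-filter-tabulate (f ∘ suc) (b ∘ suc) (eq ∘ suc)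
  ... | false | _ | refl | ih = ih
  ... | true  | _ | refl | ih = cong suc ih

module _ {A B : Set} {P : Pred (A × B) 0ℓ} (P? : Decidable P) where

  length-filter-cartesianProduct :
    ∀ {m n} (f : Fin m → A) (g : Fin n → B) (b : ℕ → ℕ → Bool) →
    (∀ i j → does (P? (f i , g j)) ≡ b (toℕ i) (toℕ j)) →
    List.length (filter P? (cartesianProduct (tabulate f) (tabulate g))) ≡
    ∑ m (λ i → ∑ n (λ j → indicator (b i j)))
  length-filter-cartesianProduct {zero}  f g b eq = refl
  length-filter-cartesianProduct {suc m} {n} f g b eq = begin
    List.length (filter P? (row ++ rows))                         ≡⟨ cong List.length (filter-++ P? row rows) ⟩
    List.length (filter P? row ++ filter P? rows)                 ≡⟨ length-++ (filter P? row) ⟩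
    List.length (filter P? row) + List.length (filter P? rows)    ≡⟨ cong₂ _+_ row≡ rows≡ ⟩
    ∑ (suc m) (λ i → ∑ n (λ j → indicator (b i j)))               ∎
    where
    open ≡-Reasoning
    row  = map (f zero ,_) (tabulate g)
    rows = cartesianProduct (tabulate (f ∘ suc)) (tabulate g)

    row≡ : List.length (filter P? row) ≡ ∑ n (indicator ∘ b 0)
    row≡ = trans (cong (List.length ∘ filter P?) (map-tabulate g (f zero ,_)))
                 (length-filter-tabulate P? _ (b 0) (eq zero))

    rows≡ = length-filter-cartesianProduct (f ∘ suc) g (b ∘ suc) (eq ∘ suc)

-- Each edge is counted at its smaller endpoint. On `cone r e` the count reduces to the sum of `r`
-- plus the count for `e`, since `i <ᵇ j` discards column 0.
edgeCount : (ℕ → ℕ → Bool) → ℕ → ℕ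
edgeCount e n = ∑ n λ i → ∑ n λ j → indicator ((i <ᵇ j) ∧ e i j)

-- `allFin n` is `tabulate id`, and the `does` of the decision in `edges` reduces to this
-- conjunction.
size≡edgeCount : ∀ n → size (G n) ≡ edgeCount adjacent n
size≡edgeCount n = length-filter-cartesianProduct _ {n} {n} id id
  (λ i j → (i <ᵇ j) ∧ adjacent i j) (λ _ _ → refl)

∑-odd : ∀ n → ∑ n (indicator ∘ odd) ≡ ⌊ n /2⌋
∑-odd 0             = refl
∑-odd 1             = refl
∑-odd (suc (suc n)) = cong suc (∑-odd n)

∑-const0 : ∀ n → ∑ n (λ _ → 0) ≡ 0
∑-const0 zero    = refl
∑-const0 (suc n) = ∑-const0 n

-- Since (n + 2)² = n² + 4(n + 1), the rounded quarter grows by exactly n + 1.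
quarter-square : ∀ n → (2 + n) ^ 2 / 4 ≡ suc n + n ^ 2 / 4
quarter-square n = begin
  (2 + n) ^ 2 / 4                ≡⟨ cong (_/ 4) (expand n) ⟩
  (n ^ 2 + suc n * 4) / 4        ≡⟨ +-distrib-/-∣ʳ (n ^ 2) (n∣m*n (suc n)) ⟩
  n ^ 2 / 4 + suc n * 4 / 4      ≡⟨ cong (n ^ 2 / 4 +_) (m*n/n≡m (suc n) 4) ⟩
  n ^ 2 / 4 + suc n              ≡⟨ +-comm (n ^ 2 / 4) (suc n) ⟩
  suc n + n ^ 2 / 4              ∎
  where
  open ≡-Reasoning
  -- The squares are unfolded because the solver does not accept _^_.
  expand : ∀ n → (2 + n) * ((2 + n) * 1) ≡ n * (n * 1) + (1 + n) * 4
  expand = solve-∀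

-- Induction in steps of two: the first two vertices, one from each class, meet `suc n` edges in
-- all, the increment in `quarter-square`.
edgeCount-alternating : ∀ n → edgeCount alternating n ≡ n ^ 2 / 4
edgeCount-alternating 0             = refl
edgeCount-alternating 1             = refl
edgeCount-alternating (suc (suc n)) = begin
  -- The rows of 0 and 1; the leading term `odd 0` of each sum contributes 0.
  ∑ (2 + n) (indicator ∘ odd) + (∑ (1 + n) (indicator ∘ odd) + edgeCount alternating n)
    ≡⟨ cong₂ _+_ (∑-odd (2 + n)) (cong₂ _+_ (∑-odd (1 + n)) (edgeCount-alternating n)) ⟩
  suc ⌊ n /2⌋ + (⌈ n /2⌉ + n ^ 2 / 4)
    ≡⟨ +-assoc (suc ⌊ n /2⌋) ⌈ n /2⌉ (n ^ 2 / 4) ⟨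
  suc (⌊ n /2⌋ + ⌈ n /2⌉) + n ^ 2 / 4
    ≡⟨ cong (λ k → suc k + n ^ 2 / 4) (⌊n/2⌋+⌈n/2⌉≡n n) ⟩
  suc n + n ^ 2 / 4
    ≡⟨ quarter-square n ⟨
  (2 + n) ^ 2 / 4 ∎
  where open ≡-Reasoning

edgeCount-adjacent : ∀ n → edgeCount adjacent (4 + n) ≡ (3 + n) ^ 2 / 4 + 2
edgeCount-adjacent n = begin
  -- The rows of 0, 1 and 2 in turn, then the `1 + n` vertices from 3 on, among which the graph is
  -- `alternating`.
  2 + ∑ n (indicator ∘ odd) +
    (1 + ∑ (1 + n) (indicator ∘ odd) + (1 + ∑ n (λ _ → 0) + edgeCount alternating (1 + n)))
    ≡⟨ cong₂ (λ a b → 2 + a + b) (∑-odd n)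
         (cong₂ (λ a b → 1 + a + b) (∑-odd (1 + n))
           (cong₂ (λ a b → 1 + a + b) (∑-const0 n) (edgeCount-alternating (1 + n)))) ⟩
  2 + ⌊ n /2⌋ + (1 + ⌈ n /2⌉ + (1 + 0 + (1 + n) ^ 2 / 4))
    ≡⟨ regroup ⌊ n /2⌋ ⌈ n /2⌉ ((1 + n) ^ 2 / 4) ⟩
  2 + (⌊ n /2⌋ + ⌈ n /2⌉) + (1 + n) ^ 2 / 4 + 2
    ≡⟨ cong (λ k → 2 + k + (1 + n) ^ 2 / 4 + 2) (⌊n/2⌋+⌈n/2⌉≡n n) ⟩
  2 + n + (1 + n) ^ 2 / 4 + 2
    ≡⟨ cong (_+ 2) (quarter-square (1 + n)) ⟨
  (3 + n) ^ 2 / 4 + 2 ∎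
  where
  open ≡-Reasoning
  regroup : ∀ a b c → 2 + a + (1 + b + (1 + 0 + c)) ≡ 2 + (a + b) + c + 2
  regroup = solve-∀

theorem4 : ∀ (n : ℕ) → 6 ≤ n →
    Σ[ G ∈ Graph n ]
    ( ¬ Bipartite G
    × size G ≡ (n ∸ 1) ^ 2 / 4 + 2
    × HoldsForExactly 3 (WeaklyPancyclic G) )
theorem4 _ (s≤s (s≤s (s≤s (s≤s (s≤s (s≤s {n = m} z≤n)))))) =
  G (6 + m) , ¬bipartite (3 + m)
  , trans (size≡edgeCount (6 + m)) (edgeCount-adjacent (2 + m))
  , exactlyThree m
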